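{- Let $\sigma$ be a signature of the complete graph $K_n$ and let $E^-(K_n,\sigma)$ be its set of negative edges. If $|E^-(K_n,\sigma)|<n/2$, then $l(K_n,\sigma)=|E^-(K_n,\sigma)|$.
   Context: $K_n$ is the simple complete graph on $n$ vertices; a signature is a map $\sigma:E(K_n)\to\{+,-\}$. A circle is a connected 2-regular subgraph; its sign is the product of its edge signs. A signed graph is balanced if all circles are positive. The frustration index $l(\Sigma)$ is the smallest number of edges whose deletion leaves a balanced signed graph. -}

module Defs where

open import Data.Nat using (ℕ; _<_; _≤_; _*_)
open import Data.Nat.Properties using (_<?_)
open import Data.Fin using (Fin; toℕ)
open import Data.Bool using (Bool; true; false)
open import Data.Sign using (Sign; +; -) renaming (_*_ to _⊙_)
import Data.Sign.Properties as SignP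
open import Data.List using (List; []; _∷_; length; filter; foldr; map; cartesianProduct; allFin)
open import Data.List.Relation.Unary.All using (All)
open import Data.List.Relation.Unary.Unique.Propositional using (Unique)
open import Data.Product using (_×_; _,_; Σ; ∃)
open import Relation.Binary.PropositionalEquality using (_≡_)
open import Relation.Nullary.Decidable using (¬?)
import Data.Bool.Properties as BoolP

-- A signature of K_n: a sign on every unordered pair {i,j}, i ≠ j,
-- encoded as a symmetric function (diagonal values are irrelevant).
Signature : ℕ → Set
Signature n = Fin n → Fin n → Sign

SymmetricFn : ∀ {n} {A : Set} → (Fin n → Fin n → A) → Set
SymmetricFn f = ∀ i j → f i j ≡ f j i

-- The edges of K_n, each unordered pair {i,j} listed once as (i , j) with i < j.
edges : (n : ℕ) → List (Fin n × Fin n)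
edges n = filter (λ { (i , j) → toℕ i <? toℕ j }) (cartesianProduct (allFin n) (allFin n))

-- Negative edges E^-(K_n, σ)
negEdges : ∀ {n} → Signature n → List (Fin n × Fin n)
negEdges {n} σ = filter (λ { (i , j) → σ i j SignP.≟ - }) (edges n)

-- A set of edges to delete, as a symmetric Boolean predicate on pairs.
EdgeSet : ℕ → Set
EdgeSet n = Fin n → Fin n → Bool

-- Number of edges of K_n in D
size : ∀ {n} → EdgeSet n → ℕ
size {n} D = length (filter (λ { (i , j) → D i j BoolP.≟ true }) (edges n))

-- Closed edge sequence of a cyclic vertex sequence v0 v1 ... v_{k-1}:
-- (v0,v1), (v1,v2), ..., (v_{k-1}, v0).
closeEdges : ∀ {n} → Fin n → List (Fin n) → List (Fin n × Fin n)
closeEdges first [] = []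
closeEdges first (x ∷ []) = (x , first) ∷ []
closeEdges first (x ∷ y ∷ r) = (x , y) ∷ closeEdges first (y ∷ r)

cycleEdges : ∀ {n} → List (Fin n) → List (Fin n × Fin n)
cycleEdges [] = []
cycleEdges (v ∷ vs) = closeEdges v (v ∷ vs)

-- A circle of K_n \ D: a cyclic sequence of ≥ 3 distinct vertices whose
-- consecutive edges (including the closing one) are all not deleted.
-- (In a simple graph every connected 2-regular subgraph is exactly of this form.)
IsCircleAvoiding : ∀ {n} → EdgeSet n → List (Fin n) → Set
IsCircleAvoiding D vs =
  (3 ≤ length vs) × Unique vs × All (λ { (i , j) → D i j ≡ false }) (cycleEdges vs)

-- Sign of a circle: product of its edge signs.
circleSign : ∀ {n} → Signature n → List (Fin n) → Sign
circleSign σ vs = foldr (λ { (i , j) s → σ i j ⊙ s }) + (cycleEdges vs)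

-- (K_n \ D, σ) is balanced: every circle is positive.
BalancedAfterDeleting : ∀ {n} → Signature n → EdgeSet n → Set
BalancedAfterDeleting σ D = ∀ vs → IsCircleAvoiding D vs → circleSign σ vs ≡ +

-- l(K_n, σ) = k : k is the minimum number of edges whose deletion leaves
-- a balanced signed graph.
IsFrustrationIndex : ∀ {n} → Signature n → ℕ → Set
IsFrustrationIndex {n} σ k =
  (Σ (EdgeSet n) λ D → SymmetricFn D × BalancedAfterDeleting σ D × size D ≡ k)
  × (∀ (D : EdgeSet n) → SymmetricFn D → BalancedAfterDeleting σ D → k ≤ size D)

{-# OPTIONS --safe #-}
-- Deleting the negative edges balances (K_n, σ), so l ≤ m := |E⁻|. Conversely, let D balance
-- (K_n, σ) with |D| < m. Some negative edge uv survives the deletion, and for each of the n − 2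
-- other vertices w the triangle uvw would be a negative circle unless uw or vw is deleted or
-- negative. So uv and one such edge per w are n − 1 distinct edges of D ∪ E⁻, whence
-- n − 1 ≤ |D| + m ≤ 2m − 1, contradicting 2m < n.
module Submission where

open import Defs
open import Level using (Level; 0ℓ)
open import Function using (id; _∘_; Injective)
open import Data.Nat using (ℕ; zero; suc; _+_; _*_; _≤_; _<_; s≤s; z≤n)
open import Data.Nat.Properties
  using (≤-refl; ≤-reflexive; ≤-trans; ≤-pred; <⇒≤; ≮⇒≥; <-irrefl; n≤1+n; +-suc; +-identityʳ;
         +-mono-≤; +-monoʳ-≤; +-monoˡ-≤; module ≤-Reasoning)
open import Data.Fin using (Fin; toℕ; punchIn; punchOut)
open import Data.Fin.Properties
  using (<-cmp; <⇒≢; injective⇒≤; punchIn-injective; punchInᵢ≢i; punchIn-punchOut)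
open import Data.Bool as Bool using (Bool; true; false)
open import Data.Bool.Properties using (¬-not)
open import Data.Sign as Sign using (Sign)
open import Data.List using (List; []; _∷_; length; filter; foldr; lookup; cartesianProduct; allFin)
open import Data.List.Membership.Propositional using (_∈_)
open import Data.List.Membership.Propositional.Properties
  using (∈-filter⁺; ∈-filter⁻; ∈-cartesianProduct⁺; ∈-allFin)
open import Data.List.Properties using (filter-≐)
open import Data.List.Relation.Unary.Any using (here; there)
open import Data.List.Relation.Unary.Any.Properties using (lookup-index)
open import Data.List.Relation.Unary.All as All using (All; []; _∷_)
open import Data.List.Relation.Unary.AllPairs using ([]; _∷_)
open import Data.Product
  using (Σ-syntax; ∃; _×_; _,_; proj₁; proj₂; uncurry; map₁; map₂; swap)
open import Data.Product.Properties using (,-injective)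
open import Data.Sum as Sum using (_⊎_; inj₁; inj₂; [_,_]′)
open import Relation.Nullary using (¬_; yes; no; contradiction; _⊎-dec_)
open import Relation.Unary using (Pred; Decidable; _⊆_; _∪_)
open import Relation.Binary.PropositionalEquality
  using (_≡_; _≢_; refl; sym; trans; cong; ≢-sym)
open import Relation.Binary using (tri<; tri≈; tri>)

private
  variable
    a p q r ℓ : Level
    n : ℕ

module _ {A : Set a} {P : Pred A p} {Q : Pred A q} (P? : Decidable P) (Q? : Decidable Q) where

  length-filter-<⇒∃ : ∀ xs → length (filter Q? xs) < length (filter P? xs) →
                      ∃ λ x → x ∈ xs × P x × ¬ Q x
  length-filter-<⇒∃ (x ∷ xs) lt with P? x | Q? x
  ... | yes px | no ¬qx = x , here refl , px , ¬qx
  ... | yes _  | yes _  = map₂ (map₁ there) (length-filter-<⇒∃ xs (≤-pred lt))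
  ... | no _   | yes _  = map₂ (map₁ there) (length-filter-<⇒∃ xs (<⇒≤ lt))
  ... | no _   | no _   = map₂ (map₁ there) (length-filter-<⇒∃ xs lt)

length-filter-∷ : {A : Set a} {P : Pred A p} (P? : Decidable P) (x : A) (xs : List A) →
                  length (filter P? xs) ≤ length (filter P? (x ∷ xs))
length-filter-∷ P? x xs with P? x
... | yes _ = n≤1+n _
... | no _  = ≤-refl

module _ {A : Set a} {R : Pred A r} {P : Pred A p} {Q : Pred A q}
         (R? : Decidable R) (P? : Decidable P) (Q? : Decidable Q) (R⊆P∪Q : R ⊆ P ∪ Q) where

  length-filter-⊆-∪ : ∀ xs →
                      length (filter R? xs) ≤ length (filter P? xs) + length (filter Q? xs)
  length-filter-⊆-∪ [] = z≤n
  length-filter-⊆-∪ (x ∷ xs) with ih ← length-filter-⊆-∪ xs | R? x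
  ... | no _ = ≤-trans ih (+-mono-≤ (length-filter-∷ P? x xs) (length-filter-∷ Q? x xs))
  ... | yes rx with P? x
  ... | yes _ = s≤s (≤-trans ih (+-monoʳ-≤ _ (length-filter-∷ Q? x xs)))
  ... | no ¬px with Q? x
  ... | yes _ = ≤-trans (s≤s ih) (≤-reflexive (sym (+-suc _ _)))
  ... | no ¬qx = contradiction (R⊆P∪Q rx) [ ¬px , ¬qx ]′

injective⇒≤-length : {A : Set a} {k : ℕ} {xs : List A} (f : Fin k → A) →
                     Injective _≡_ _≡_ f → (∀ i → f i ∈ xs) → k ≤ length xs
injective⇒≤-length {xs = xs} f f-injective f∈xs = injective⇒≤ λ {i} {j} eq →
  f-injective (trans (lookup-index (f∈xs i))
                     (trans (cong (lookup xs) eq) (sym (lookup-index (f∈xs j)))))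

∈-edges⁺ : {i j : Fin n} → toℕ i < toℕ j → (i , j) ∈ edges n
∈-edges⁺ {i = i} {j} i<j = ∈-filter⁺ _ (∈-cartesianProduct⁺ (∈-allFin i) (∈-allFin j)) i<j

∈-edges⁻ : {i j : Fin n} → (i , j) ∈ edges n → toℕ i < toℕ j
∈-edges⁻ {n} = proj₂ ∘ ∈-filter⁻ _ {xs = cartesianProduct (allFin n) (allFin n)}

edge : Fin n → Fin n → Fin n × Fin n
edge i j with <-cmp i j
... | tri> _ _ _ = j , i
... | _          = i , j

edge-∈-edges : {i j : Fin n} → i ≢ j → edge i j ∈ edges n
edge-∈-edges {i = i} {j} i≢j with <-cmp i j
... | tri< i<j _ _ = ∈-edges⁺ i<j
... | tri≈ _ i≡j _ = contradiction i≡j i≢j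
... | tri> _ _ j<i = ∈-edges⁺ j<i

edge-cases : (i j : Fin n) → edge i j ≡ (i , j) ⊎ edge i j ≡ (j , i)
edge-cases i j with <-cmp i j
... | tri< _ _ _ = inj₁ refl
... | tri≈ _ _ _ = inj₁ refl
... | tri> _ _ _ = inj₂ refl

edge-injective : {i j k l : Fin n} → edge i j ≡ edge k l → (i ≡ k × j ≡ l) ⊎ (i ≡ l × j ≡ k)
edge-injective {i = i} {j} {k} {l} eq with edge-cases i j | edge-cases k l
... | inj₁ ij | inj₁ kl = inj₁ (,-injective (trans (sym ij) (trans eq kl)))
... | inj₁ ij | inj₂ lk = inj₂ (,-injective (trans (sym ij) (trans eq lk)))
... | inj₂ ji | inj₁ kl = inj₂ (swap (,-injective (trans (sym ji) (trans eq kl))))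
... | inj₂ ji | inj₂ lk = inj₁ (swap (,-injective (trans (sym ji) (trans eq lk))))

uncurry-edge : {A : Set} {f : Fin n → Fin n → A} → SymmetricFn f → (i j : Fin n) →
               uncurry f (edge i j) ≡ f i j
uncurry-edge {f = f} f-sym i j with edge-cases i j
... | inj₁ ij = cong (uncurry f) ij
... | inj₂ ji = trans (cong (uncurry f) ji) (f-sym j i)

module _ {k : ℕ} {u v : Fin (suc (suc k))} (u≢v : u ≢ v) where

  others : Fin k → Fin (suc (suc k))
  others = punchIn u ∘ punchIn (punchOut u≢v)

  others-injective : Injective _≡_ _≡_ others
  others-injective = punchIn-injective _ _ _ ∘ punchIn-injective u _ _

  others≢u : ∀ j → others j ≢ u
  others≢u j = punchInᵢ≢i u _

  others≢v : ∀ j → others j ≢ v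
  others≢v j eq =
    punchInᵢ≢i _ j (punchIn-injective u _ _ (trans eq (sym (punchIn-punchOut u≢v))))

DominatingEdge : Pred (Fin n × Fin n) ℓ → Fin n → Fin n → Set ℓ
DominatingEdge B u v = B (edge u v) × (∀ w → w ≢ u → w ≢ v → B (edge u w) ⊎ B (edge v w))

dominatingEdge⇒n≤1+size : {B : Pred (Fin n × Fin n) ℓ} (B? : Decidable B) {u v : Fin n} →
                          u ≢ v → DominatingEdge B u v → n ≤ suc (length (filter B? (edges n)))
dominatingEdge⇒n≤1+size {zero} _ {()}
dominatingEdge⇒n≤1+size {suc zero} _ {Fin.zero} {Fin.zero} u≢v = contradiction refl u≢v
dominatingEdge⇒n≤1+size {suc (suc k)} {B = B} B? {u} {v} u≢v (B-uv , dominates) =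
  s≤s (injective⇒≤-length edgeFamily edgeFamily-injective edgeFamily∈B)
  where
  W : Fin k → Fin (suc (suc k))
  W = others u≢v

  W≢ : ∀ j {x} → x ≡ u ⊎ x ≡ v → W j ≢ x
  W≢ j (inj₁ refl) = others≢u u≢v j
  W≢ j (inj₂ refl) = others≢v u≢v j

  partner : ∀ j → Σ[ x ∈ Fin (suc (suc k)) ] (x ≡ u ⊎ x ≡ v) × B (edge x (W j))
  partner j with dominates (W j) (others≢u u≢v j) (others≢v u≢v j)
  ... | inj₁ b = u , inj₁ refl , b
  ... | inj₂ b = v , inj₂ refl , b

  spoke : Fin k → Fin (suc (suc k)) × Fin (suc (suc k))
  spoke j = edge (proj₁ (partner j)) (W j)

  uv≢spoke : ∀ j → edge u v ≢ spoke j
  uv≢spoke j eq with edge-injective eq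
  ... | inj₁ (_ , v≡W) = others≢v u≢v j (sym v≡W)
  ... | inj₂ (u≡W , _) = others≢u u≢v j (sym u≡W)

  edgeFamily : Fin (suc k) → Fin (suc (suc k)) × Fin (suc (suc k))
  edgeFamily Fin.zero    = edge u v
  edgeFamily (Fin.suc j) = spoke j

  edgeFamily-injective : Injective _≡_ _≡_ edgeFamily
  edgeFamily-injective {Fin.zero}  {Fin.zero}  _  = refl
  edgeFamily-injective {Fin.zero}  {Fin.suc j} eq = contradiction eq (uv≢spoke j)
  edgeFamily-injective {Fin.suc i} {Fin.zero}  eq = contradiction (sym eq) (uv≢spoke i)
  edgeFamily-injective {Fin.suc i} {Fin.suc j} eq with edge-injective eq
  ... | inj₁ (_ , Wi≡Wj) = cong Fin.suc (others-injective u≢v Wi≡Wj)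
  ... | inj₂ (_ , Wi≡x)  = let _ , x∈uv , _ = partner j in contradiction Wi≡x (W≢ i x∈uv)

  edgeFamily∈B : ∀ i → edgeFamily i ∈ filter B? (edges (suc (suc k)))
  edgeFamily∈B Fin.zero    = ∈-filter⁺ B? (edge-∈-edges u≢v) B-uv
  edgeFamily∈B (Fin.suc j) =
    let _ , x∈uv , B-spoke = partner j in ∈-filter⁺ B? (edge-∈-edges (≢-sym (W≢ j x∈uv))) B-spoke

isNegative : Sign → Bool
isNegative Sign.- = true
isNegative Sign.+ = false

isNegative-true : ∀ {s} → isNegative s ≡ true → s ≡ Sign.-
isNegative-true {Sign.-} _ = refl

isNegative-false : ∀ {s} → isNegative s ≡ false → s ≡ Sign.+
isNegative-false {Sign.+} _ = refl

product-of-positives : {A : Set a} (f : A → Sign) {xs : List A} →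
                       All (λ x → f x ≡ Sign.+) xs → foldr (λ x s → f x Sign.* s) Sign.+ xs ≡ Sign.+
product-of-positives f []            = refl
product-of-positives f (fx≡+ ∷ fxs≡+) rewrite fx≡+ = product-of-positives f fxs≡+

negativeEdgeSet : Signature n → EdgeSet n
negativeEdgeSet σ i j = isNegative (σ i j)

negativeEdgeSet-symmetric : {σ : Signature n} → SymmetricFn σ → SymmetricFn (negativeEdgeSet σ)
negativeEdgeSet-symmetric σ-sym i j = cong isNegative (σ-sym i j)

negativeEdgeSet-balanced : (σ : Signature n) → BalancedAfterDeleting σ (negativeEdgeSet σ)
negativeEdgeSet-balanced σ _ (_ , _ , kept) =
  product-of-positives (uncurry σ) (All.map isNegative-false kept)

size-negativeEdgeSet : (σ : Signature n) → size (negativeEdgeSet σ) ≡ length (negEdges σ)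
size-negativeEdgeSet {n} σ =
  cong length (filter-≐ _ _ (isNegative-true , cong isNegative) (edges n))

Blocked : Signature n → EdgeSet n → Pred (Fin n × Fin n) 0ℓ
Blocked σ D e = uncurry D e ≡ true ⊎ uncurry σ e ≡ Sign.-

blocked? : (σ : Signature n) (D : EdgeSet n) → Decidable (Blocked σ D)
blocked? σ D e = (uncurry D e Bool.≟ true) ⊎-dec (uncurry σ e Sign.≟ Sign.-)

blocked-or-keptPositive : (d : Bool) (s : Sign) →
                          (d ≡ true ⊎ s ≡ Sign.-) ⊎ (d ≡ false × s ≡ Sign.+)
blocked-or-keptPositive true  _      = inj₁ (inj₁ refl)
blocked-or-keptPositive false Sign.- = inj₁ (inj₂ refl)
blocked-or-keptPositive false Sign.+ = inj₂ (refl , refl)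

module _ {σ : Signature n} {D : EdgeSet n}
         (σ-sym : SymmetricFn σ) (D-sym : SymmetricFn D) (balanced : BalancedAfterDeleting σ D) where

  blocked-edge : ∀ {i j} → Blocked σ D (i , j) → Blocked σ D (edge i j)
  blocked-edge {i} {j} =
    Sum.map (trans (uncurry-edge D-sym i j)) (trans (uncurry-edge σ-sym i j))

  keptNegativeEdge-dominating : ∀ {u v} → u ≢ v → σ u v ≡ Sign.- → D u v ≡ false →
                                DominatingEdge (Blocked σ D) u v
  keptNegativeEdge-dominating {u} {v} u≢v σuv≡- Duv≡false =
    blocked-edge (inj₂ σuv≡-) , λ w w≢u w≢v → Sum.map blocked-edge blocked-edge (triangle w w≢u w≢v)
    where
    triangle : ∀ w → w ≢ u → w ≢ v → Blocked σ D (u , w) ⊎ Blocked σ D (v , w)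
    triangle w w≢u w≢v
      with blocked-or-keptPositive (D u w) (σ u w) | blocked-or-keptPositive (D v w) (σ v w)
    ... | inj₁ b | _      = inj₁ b
    ... | inj₂ _ | inj₁ b = inj₂ b
    ... | inj₂ (Duw≡false , σuw≡+) | inj₂ (Dvw≡false , σvw≡+) =
      contradiction (balanced (u ∷ v ∷ w ∷ []) circle) negative
      where
      circle : IsCircleAvoiding D (u ∷ v ∷ w ∷ [])
      circle = s≤s (s≤s (s≤s z≤n))
             , (u≢v ∷ ≢-sym w≢u ∷ []) ∷ (≢-sym w≢v ∷ []) ∷ [] ∷ []
             , Duv≡false ∷ Dvw≡false ∷ trans (D-sym w u) Duw≡false ∷ []

      negative : circleSign σ (u ∷ v ∷ w ∷ []) ≢ Sign.+
      negative rewrite σuv≡- | σvw≡+ | σ-sym w u | σuw≡+ = λ ()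

frustrationIndex-lowerBound : {σ : Signature n} → SymmetricFn σ → 2 * length (negEdges σ) < n →
                              (D : EdgeSet n) → SymmetricFn D → BalancedAfterDeleting σ D →
                              length (negEdges σ) ≤ size D
frustrationIndex-lowerBound {n} {σ} σ-sym 2m<n D D-sym balanced = ≮⇒≥ λ |D|<m →
  let (u , v) , uv∈edges , σuv≡- , Duv≢true = length-filter-<⇒∃ _ _ (edges n) |D|<m
      u≢v = <⇒≢ (∈-edges⁻ uv∈edges)
      dominating = keptNegativeEdge-dominating σ-sym D-sym balanced u≢v σuv≡- (¬-not Duv≢true)
      B? = blocked? σ D
      m = length (negEdges σ)
  in <-irrefl refl (begin-strict
    n                                   ≤⟨ dominatingEdge⇒n≤1+size B? u≢v dominating ⟩
    suc (length (filter B? (edges n)))  ≤⟨ s≤s (length-filter-⊆-∪ B? _ _ id (edges n)) ⟩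
    suc (size D + m)                    ≤⟨ +-monoˡ-≤ m |D|<m ⟩
    m + m                               ≡⟨ cong (m +_) (sym (+-identityʳ m)) ⟩
    2 * m                               <⟨ 2m<n ⟩
    n                                   ∎)
  where open ≤-Reasoning

mainTheorem7 : (n : ℕ) (σ : Signature n) → SymmetricFn σ →
               2 * length (negEdges σ) < n →
               IsFrustrationIndex σ (length (negEdges σ))
mainTheorem7 n σ σ-sym 2m<n =
  ( negativeEdgeSet σ
  , negativeEdgeSet-symmetric σ-sym
  , negativeEdgeSet-balanced σ
  , size-negativeEdgeSet σ )
  , frustrationIndex-lowerBound σ-sym 2m<n
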